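{- The class of finite conservative commutative residuated lattices is precisely the class of Catalan algebras (classes being understood up to isomorphism).
   Context: A commutative residuated lattice is an algebra $\mathbf A=\langle A,\wedge,\vee,\cdot,\to,\mathrm e\rangle$ such that $\langle A,\wedge,\vee\rangle$ is a lattice, $\langle A,\cdot,\mathrm e\rangle$ is a commutative monoid, and $ab\le c\iff b\le a\to c$ for all $a,b,c\in A$. It is conservative if $ab\in\{a,b\}$ for all $a,b$. Its monoidal order is $x\sqsubseteq y$ iff $xy=x$; in the commutative conservative case this is a total order with greatest element $\mathrm e$, and it determines the product ($xy$ is the $\sqsubseteq$-meet of $x$ and $y$). For finite $\mathbf A$, $\bot^{\mathbf A}$ is the least element of the lattice. Catalan sum: for finite commutative conservative residuated lattices $\mathbf A,\mathbf B$, the algebra $\mathbf C=\mathbf A\,\copyright\,\mathbf B$ has as universe $C$ the disjoint union of $A$ and $B$, with lattice order $${\le^{\mathbf C}}={\le^{\mathbf A}}\cup{\le^{\mathbf B}}\cup(\{\bot^{\mathbf A}\}\times B)\cup(A\times{\uparrow}\mathrm e^{\mathbf B}),\qquad {\uparrow}\mathrm e^{\mathbf B}=\{b\in B:\mathrm e^{\mathbf B}\le^{\mathbf B} b\},$$ and monoidal order $${\sqsubseteq^{\mathbf C}}={\sqsubseteq^{\mathbf A}}\cup{\sqsubseteq^{\mathbf B}}\cup(\{\bot^{\mathbf A}\}\times B)\cup(B\times(A\setminus\{\bot^{\mathbf A}\})),$$ where $\{\bot^{\mathbf A}\}\times B$ etc. are sets of pairs in the relation. The product of $\mathbf C$ is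 the meet of the total order $\sqsubseteq^{\mathbf C}$, the identity is its greatest element (so $\mathrm e^{\mathbf C}=\mathrm e^{\mathbf A}$ if $|A|>1$ and $\mathrm e^{\mathbf C}=\mathrm e^{\mathbf B}$ otherwise), and $\to$ is the residual of the product, $x\to y=\max\{z: xz\le^{\mathbf C} y\}$. An algebra is Catalan if it is a one-element algebra (in the language of residuated lattices) or is a Catalan sum of Catalan algebras; that is, the class of Catalan algebras is the smallest class, closed under isomorphism, containing the one-element algebra and closed under $\copyright$. -}

module Defs where

open import Level using (Level; suc; _⊔_)
open import Algebra.Core using (Op₂)
open import Algebra.Definitions using (Selective)
open import Algebra.Lattice.Bundles using (Lattice)
import Algebra.Lattice.Properties.Lattice as LatticeProperties
open import Algebra.Morphism.Definitions using (Homomorphic₀; Homomorphic₂)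
open import Algebra.Structures using (IsCommutativeMonoid)
import Algebra.Lattice.Structures as LatticeStructures
open import Data.Fin.Base using (Fin) renaming (zero to fzero; suc to fsuc)
import Data.Fin.Properties as Fin
open import Data.Nat.Base using () renaming (zero to nzero; suc to nsuc)
open import Data.Product.Base using (∃; _×_; _,_; proj₁; proj₂)
open import Data.Sum.Base using (_⊎_; inj₁; inj₂; [_,_]′)
open import Data.Unit.Polymorphic.Base using (⊤; tt)
open import Function.Bundles using (_↔_; _⇔_; Inverse; Equivalence)
open import Function.Properties.Inverse using (Inverse⇒Injection)
open import Relation.Binary.Core using (Rel)
open import Relation.Binary.Definitions using (Maximum; Minimum; DecidableEquality)
import Relation.Binary.Construct.NaturalOrder.Left as NaturalOrder
open import Relation.Binary.Lattice using (Infimum; Supremum)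
import Relation.Binary.Lattice as OrderLattice
open import Relation.Binary.PropositionalEquality
  using (_≡_; _≢_; refl; sym; trans; subst)
open import Relation.Nullary using (Dec; yes; no; contradiction)
open import Relation.Nullary.Decidable using (via-injection)

private
  variable
    a : Level

record RawResiduatedLattice a : Set (suc a) where
  infixr 8 _·_
  infixr 7 _∧_
  infixr 6 _∨_
  infixr 5 _⇒_
  field
    Carrier : Set a
    _∧_     : Op₂ Carrier
    _∨_     : Op₂ Carrier
    _·_     : Op₂ Carrier
    _⇒_     : Op₂ Carrier
    e       : Carrier

  -- x ≤ y unfolds to x ≡ x ∧ y, and x ⊑ y (the monoidal order) to x ≡ x · y.
  open NaturalOrder _≡_ _∧_ public using (_≤_)
  open NaturalOrder _≡_ _·_ public using () renaming (_≤_ to _⊑_)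

record IsCommutativeResiduatedLattice (A : RawResiduatedLattice a) : Set a where
  open RawResiduatedLattice A
  field
    isLattice           : LatticeStructures.IsLattice _≡_ _∨_ _∧_
    isCommutativeMonoid : IsCommutativeMonoid _≡_ _·_ e
    residuation         : ∀ x y z → (x · y ≤ z) ⇔ (y ≤ x ⇒ z)

Conservative : RawResiduatedLattice a → Set a
Conservative A = Selective _≡_ _·_
  where open RawResiduatedLattice A

Finite : RawResiduatedLattice a → Set a
Finite A = ∃ λ n → Carrier ↔ Fin n
  where open RawResiduatedLattice A

record IsFiniteConservativeCRL (A : RawResiduatedLattice a) : Set a where
  field
    isCommutativeResiduatedLattice : IsCommutativeResiduatedLattice A
    conservative                   : Conservative A
    finite                         : Finite A

record FiniteConservativeCRL a : Set (suc a) where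
  field
    raw                     : RawResiduatedLattice a
    isFiniteConservativeCRL : IsFiniteConservativeCRL raw

record _≅_ (A B : RawResiduatedLattice a) : Set a where
  private
    module A = RawResiduatedLattice A
    module B = RawResiduatedLattice B
  field
    bijection : A.Carrier ↔ B.Carrier

  open Inverse bijection public using (to; from)

  field
    ∧-homo : Homomorphic₂ A.Carrier B.Carrier _≡_ to A._∧_ B._∧_
    ∨-homo : Homomorphic₂ A.Carrier B.Carrier _≡_ to A._∨_ B._∨_
    ·-homo : Homomorphic₂ A.Carrier B.Carrier _≡_ to A._·_ B._·_
    ⇒-homo : Homomorphic₂ A.Carrier B.Carrier _≡_ to A._⇒_ B._⇒_
    e-homo : Homomorphic₀ A.Carrier B.Carrier _≡_ to A.e B.e

-- x ⇒ y is the ≤-greatest z such that x · z ≤ y.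
Residual : {ℓ : Level} {C : Set a} → Rel C ℓ → Op₂ C → Op₂ C → Set (a ⊔ ℓ)
Residual _≤_ _·_ _⇒_ =
  ∀ x y → ((x · (x ⇒ y)) ≤ y) × (∀ z → (x · z) ≤ y → z ≤ (x ⇒ y))

module Properties (𝐀 : FiniteConservativeCRL a) where
  open FiniteConservativeCRL 𝐀 public
  open RawResiduatedLattice raw public
  open IsFiniteConservativeCRL isFiniteConservativeCRL public
  open IsCommutativeResiduatedLattice isCommutativeResiduatedLattice public
  open IsCommutativeMonoid isCommutativeMonoid public
    using (assoc; comm; identityˡ; identityʳ; isSemigroup)

  lattice : Lattice a a
  lattice = record { isLattice = isLattice }

  open OrderLattice.IsLattice
    (LatticeProperties.∨-∧-isOrderTheoreticLattice lattice) public
    using (supremum; infimum; antisym)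
    renaming (refl to ≤-refl; trans to ≤-trans)

  infix 4 _≟_
  _≟_ : DecidableEquality Carrier
  _≟_ = via-injection (Inverse⇒Injection (proj₂ finite)) Fin._≟_

  residualˡ : ∀ {x y z} → x · y ≤ z → y ≤ x ⇒ z
  residualˡ = Equivalence.to (residuation _ _ _)

  residualʳ : ∀ {x y z} → y ≤ x ⇒ z → x · y ≤ z
  residualʳ = Equivalence.from (residuation _ _ _)

  private
    lowerBound : ∀ n (f : Fin n → Carrier) → ∃ λ m → ∀ i → m ≤ f i
    lowerBound nzero    f = e , λ ()
    lowerBound (nsuc n) f =
      let m , m≤         = lowerBound n (λ i → f (fsuc i))
          m≤f₀ , m≤m , _ = infimum (f fzero) m
      in f fzero ∧ m , λ { fzero → m≤f₀ ; (fsuc i) → ≤-trans m≤m (m≤ i) }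

    least : ∃ (Minimum _≤_)
    least =
      let n , A↔Fin = finite
          open Inverse A↔Fin
          m , m≤ = lowerBound n from
      in m , λ x → subst (m ≤_) (strictlyInverseʳ x) (m≤ (to x))

  bot : Carrier
  bot = proj₁ least

  bot-minimum : Minimum _≤_ bot
  bot-minimum = proj₂ least

  bot-zeroʳ : ∀ x → x · bot ≡ bot
  bot-zeroʳ x = antisym (residualʳ (bot-minimum _)) (bot-minimum _)

  bot-zeroˡ : ∀ x → bot · x ≡ bot
  bot-zeroˡ x = trans (comm bot x) (bot-zeroʳ x)

  top : Carrier
  top = bot ⇒ bot

  top-maximum : Maximum _≤_ top
  top-maximum x = residualˡ (subst (_≤ bot) (sym (bot-zeroˡ x)) ≤-refl)

  ·-idem : ∀ x → x · x ≡ x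
  ·-idem x = [ (λ p → p) , (λ p → p) ]′ (conservative x x)

  ·-infimum : Infimum _⊑_ _·_
  ·-infimum = NaturalOrder.infimum _≡_ _·_ record
    { isBand = record { isSemigroup = isSemigroup ; idem = ·-idem }
    ; comm   = comm
    }

  ⊑-refl : ∀ x → x ⊑ x
  ⊑-refl x = sym (·-idem x)

  e-maximum : Maximum _⊑_ e
  e-maximum x = sym (identityʳ x)

  infix 4 _≤?_
  _≤?_ : ∀ x y → Dec (x ≤ y)
  x ≤? y = x ≟ x ∧ y

module CatalanSum (𝐀 𝐁 : FiniteConservativeCRL a) where
  private
    module A = Properties 𝐀
    module B = Properties 𝐁

  Carrier : Set a
  Carrier = A.Carrier ⊎ B.Carrier

  infix 4 _≤_ _⊑_

  data _≤_ : Rel Carrier a where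
    ≤ᴬ  : ∀ {x y} → x A.≤ y   → inj₁ x ≤ inj₁ y
    ≤ᴮ  : ∀ {x y} → x B.≤ y   → inj₂ x ≤ inj₂ y
    ⊥≤  : ∀ {x y} → x ≡ A.bot → inj₁ x ≤ inj₂ y
    ≤↑e : ∀ {x y} → B.e B.≤ y → inj₁ x ≤ inj₂ y

  data _⊑_ : Rel Carrier a where
    ⊑ᴬ  : ∀ {x y} → x A.⊑ y   → inj₁ x ⊑ inj₁ y
    ⊑ᴮ  : ∀ {x y} → x B.⊑ y   → inj₂ x ⊑ inj₂ y
    ⊥⊑  : ∀ {x y} → x ≡ A.bot → inj₁ x ⊑ inj₂ y
    ⊑∖⊥ : ∀ {x y} → y ≢ A.bot → inj₂ x ⊑ inj₁ y

  -- The operations are given by formulas; each is followed by the proof of the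
  -- order-theoretic property, relative to _≤_ and _⊑_, which determines it.

  infixr 8 _·_
  infixr 7 _∧_
  infixr 6 _∨_
  infixr 5 _⇒_

  meetᴬᴮ : A.Carrier → B.Carrier → Carrier
  meetᴬᴮ x y with B.e B.≤? y
  ... | yes _ = inj₁ x
  ... | no  _ = inj₁ A.bot

  joinᴬᴮ : A.Carrier → B.Carrier → Carrier
  joinᴬᴮ x y with x A.≟ A.bot
  ... | yes _ = inj₂ y
  ... | no  _ = inj₂ (B.e B.∨ y)

  prodᴬᴮ : A.Carrier → B.Carrier → Carrier
  prodᴬᴮ x y with x A.≟ A.bot
  ... | yes _ = inj₁ x
  ... | no  _ = inj₂ y

  _∧_ : Op₂ Carrier
  inj₁ x ∧ inj₁ y = inj₁ (x A.∧ y)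
  inj₁ x ∧ inj₂ y = meetᴬᴮ x y
  inj₂ x ∧ inj₁ y = meetᴬᴮ y x
  inj₂ x ∧ inj₂ y = inj₂ (x B.∧ y)

  meetᴬᴮ-inf : ∀ x y → (meetᴬᴮ x y ≤ inj₁ x) × (meetᴬᴮ x y ≤ inj₂ y) ×
               (∀ z → z ≤ inj₁ x → z ≤ inj₂ y → z ≤ meetᴬᴮ x y)
  meetᴬᴮ-inf x y with B.e B.≤? y
  ... | yes e≤y = ≤ᴬ A.≤-refl , ≤↑e e≤y , λ _ p _ → p
  ... | no  e≰y = ≤ᴬ (A.bot-minimum x) , ⊥≤ refl , λ where
    (inj₁ z) _ (⊥≤ refl) → ≤ᴬ A.≤-refl
    (inj₁ z) _ (≤↑e e≤y) → contradiction e≤y e≰y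

  ∧-infimum : Infimum _≤_ _∧_
  ∧-infimum (inj₁ x) (inj₁ y) =
    let p , q , r = A.infimum x y in
    ≤ᴬ p , ≤ᴬ q , λ { (inj₁ z) (≤ᴬ s) (≤ᴬ t) → ≤ᴬ (r z s t) }
  ∧-infimum (inj₁ x) (inj₂ y) = meetᴬᴮ-inf x y
  ∧-infimum (inj₂ x) (inj₁ y) =
    let p , q , r = meetᴬᴮ-inf y x in q , p , λ z s t → r z t s
  ∧-infimum (inj₂ x) (inj₂ y) =
    let p , q , r = B.infimum x y in
    ≤ᴮ p , ≤ᴮ q , λ where
      (inj₂ z) (≤ᴮ s)  (≤ᴮ t)  → ≤ᴮ (r z s t)
      (inj₁ z) (⊥≤ s)  _       → ⊥≤ s
      (inj₁ z) (≤↑e _) (⊥≤ t)  → ⊥≤ t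
      (inj₁ z) (≤↑e s) (≤↑e t) → ≤↑e (r B.e s t)

  _∨_ : Op₂ Carrier
  inj₁ x ∨ inj₁ y = inj₁ (x A.∨ y)
  inj₁ x ∨ inj₂ y = joinᴬᴮ x y
  inj₂ x ∨ inj₁ y = joinᴬᴮ y x
  inj₂ x ∨ inj₂ y = inj₂ (x B.∨ y)

  joinᴬᴮ-sup : ∀ x y → (inj₁ x ≤ joinᴬᴮ x y) × (inj₂ y ≤ joinᴬᴮ x y) ×
               (∀ z → inj₁ x ≤ z → inj₂ y ≤ z → joinᴬᴮ x y ≤ z)
  joinᴬᴮ-sup x y with x A.≟ A.bot
  ... | yes x≡⊥ = ⊥≤ x≡⊥ , ≤ᴮ B.≤-refl , λ _ _ q → q
  ... | no  x≢⊥ =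
    let p , q , r = B.supremum B.e y in
    ≤↑e p , ≤ᴮ q , λ where
      (inj₂ z) (⊥≤ x≡⊥) _      → contradiction x≡⊥ x≢⊥
      (inj₂ z) (≤↑e s)  (≤ᴮ t) → ≤ᴮ (r z s t)

  ∨-supremum : Supremum _≤_ _∨_
  ∨-supremum (inj₁ x) (inj₁ y) =
    let p , q , r = A.supremum x y in
    ≤ᴬ p , ≤ᴬ q , λ where
      (inj₁ z) (≤ᴬ s)  (≤ᴬ t)  → ≤ᴬ (r z s t)
      (inj₂ z) (⊥≤ s)  (⊥≤ t)  →
        ⊥≤ (A.antisym (r A.bot (subst (A._≤ A.bot) (sym s) A.≤-refl)
                               (subst (A._≤ A.bot) (sym t) A.≤-refl))
                      (A.bot-minimum _))
      (inj₂ z) (⊥≤ _)  (≤↑e t) → ≤↑e t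
      (inj₂ z) (≤↑e s) _       → ≤↑e s
  ∨-supremum (inj₁ x) (inj₂ y) = joinᴬᴮ-sup x y
  ∨-supremum (inj₂ x) (inj₁ y) =
    let p , q , r = joinᴬᴮ-sup y x in q , p , λ z s t → r z t s
  ∨-supremum (inj₂ x) (inj₂ y) =
    let p , q , r = B.supremum x y in
    ≤ᴮ p , ≤ᴮ q , λ { (inj₂ z) (≤ᴮ s) (≤ᴮ t) → ≤ᴮ (r z s t) }

  _·_ : Op₂ Carrier
  inj₁ x · inj₁ y = inj₁ (x A.· y)
  inj₁ x · inj₂ y = prodᴬᴮ x y
  inj₂ x · inj₁ y = prodᴬᴮ y x
  inj₂ x · inj₂ y = inj₂ (x B.· y)

  prodᴬᴮ-inf : ∀ x y → (prodᴬᴮ x y ⊑ inj₁ x) × (prodᴬᴮ x y ⊑ inj₂ y) ×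
               (∀ z → z ⊑ inj₁ x → z ⊑ inj₂ y → z ⊑ prodᴬᴮ x y)
  prodᴬᴮ-inf x y with x A.≟ A.bot
  ... | yes x≡⊥ = ⊑ᴬ (A.⊑-refl x) , ⊥⊑ x≡⊥ , λ _ p _ → p
  ... | no  x≢⊥ = ⊑∖⊥ x≢⊥ , ⊑ᴮ (B.⊑-refl y) , λ _ _ q → q

  ·-≢⊥ : ∀ x y → x ≢ A.bot → y ≢ A.bot → x A.· y ≢ A.bot
  ·-≢⊥ x y x≢⊥ y≢⊥ xy≡⊥ with A.conservative x y
  ... | inj₁ xy≡x = x≢⊥ (trans (sym xy≡x) xy≡⊥)
  ... | inj₂ xy≡y = y≢⊥ (trans (sym xy≡y) xy≡⊥)

  ⊑⊥ : ∀ {x y} → x A.⊑ y → y ≡ A.bot → x ≡ A.bot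
  ⊑⊥ {x} x⊑y refl = trans x⊑y (A.bot-zeroʳ x)

  ·-infimum : Infimum _⊑_ _·_
  ·-infimum (inj₁ x) (inj₁ y) =
    let p , q , r = A.·-infimum x y in
    ⊑ᴬ p , ⊑ᴬ q , λ where
      (inj₁ z) (⊑ᴬ s)  (⊑ᴬ t)  → ⊑ᴬ (r z s t)
      (inj₂ z) (⊑∖⊥ s) (⊑∖⊥ t) → ⊑∖⊥ (·-≢⊥ x y s t)
  ·-infimum (inj₁ x) (inj₂ y) = prodᴬᴮ-inf x y
  ·-infimum (inj₂ x) (inj₁ y) =
    let p , q , r = prodᴬᴮ-inf y x in q , p , λ z s t → r z t s
  ·-infimum (inj₂ x) (inj₂ y) =
    let p , q , r = B.·-infimum x y in
    ⊑ᴮ p , ⊑ᴮ q , λ where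
      (inj₁ z) (⊥⊑ s) _      → ⊥⊑ s
      (inj₂ z) (⊑ᴮ s) (⊑ᴮ t) → ⊑ᴮ (r z s t)

  -- e ≡ ⊥ holds in A exactly when A has one element.
  e : Carrier
  e with A.e A.≟ A.bot
  ... | yes _ = inj₂ B.e
  ... | no  _ = inj₁ A.e

  e-maximum : Maximum _⊑_ e
  e-maximum x with A.e A.≟ A.bot
  e-maximum (inj₁ x) | yes e≡⊥ = ⊥⊑ (⊑⊥ (A.e-maximum x) e≡⊥)
  e-maximum (inj₂ x) | yes _   = ⊑ᴮ (B.e-maximum x)
  e-maximum (inj₁ x) | no  _   = ⊑ᴬ (A.e-maximum x)
  e-maximum (inj₂ x) | no  e≢⊥ = ⊑∖⊥ e≢⊥

  resᴬ : A.Carrier → Carrier → Carrier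
  resᴬ x y with x A.≟ A.bot
  resᴬ x y        | yes _ = inj₂ B.top
  resᴬ x (inj₁ y) | no  _ = inj₁ (x A.⇒ y)
  resᴬ x (inj₂ y) | no  _ = inj₂ y

  _⇒_ : Op₂ Carrier
  inj₁ x ⇒ y      = resᴬ x y
  inj₂ x ⇒ inj₁ y = inj₁ A.bot
  inj₂ x ⇒ inj₂ y = inj₂ (x B.⇒ y)

  ≤top : ∀ z → z ≤ inj₂ B.top
  ≤top (inj₁ z) = ≤↑e (B.top-maximum B.e)
  ≤top (inj₂ z) = ≤ᴮ (B.top-maximum z)

  ⊥-least : ∀ {x} → x ≡ A.bot → ∀ z → inj₁ x ≤ z
  ⊥-least refl (inj₁ z) = ≤ᴬ (A.bot-minimum z)
  ⊥-least x≡⊥  (inj₂ z) = ⊥≤ x≡⊥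

  factor-⊥ : ∀ {x z} → x ≢ A.bot → x A.· z ≡ A.bot → z ≡ A.bot
  factor-⊥ {x} {z} x≢⊥ xz≡⊥ with A.conservative x z
  ... | inj₁ xz≡x = contradiction (trans (sym xz≡x) xz≡⊥) x≢⊥
  ... | inj₂ xz≡z = trans (sym xz≡z) xz≡⊥

  prodᴬᴮ-⊥ : ∀ {x} → x ≡ A.bot → ∀ y → prodᴬᴮ x y ≡ inj₁ x
  prodᴬᴮ-⊥ {x} x≡⊥ y with x A.≟ A.bot
  ... | yes _   = refl
  ... | no  x≢⊥ = contradiction x≡⊥ x≢⊥

  prodᴬᴮ-≢⊥ : ∀ {x} → x ≢ A.bot → ∀ y → prodᴬᴮ x y ≡ inj₂ y
  prodᴬᴮ-≢⊥ {x} x≢⊥ y with x A.≟ A.bot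
  ... | yes x≡⊥ = contradiction x≡⊥ x≢⊥
  ... | no  _   = refl

  res-ᴬ : ∀ x y → ((inj₁ x · resᴬ x y) ≤ y) ×
          (∀ z → (inj₁ x · z) ≤ y → z ≤ resᴬ x y)
  res-ᴬ x y with x A.≟ A.bot
  res-ᴬ x y        | yes x≡⊥ =
    subst (_≤ y) (sym (prodᴬᴮ-⊥ x≡⊥ B.top)) (⊥-least x≡⊥ y) , λ z _ → ≤top z
  res-ᴬ x (inj₁ y) | no  x≢⊥ =
    ≤ᴬ (A.residualʳ A.≤-refl) , λ where
      (inj₁ z) (≤ᴬ s) → ≤ᴬ (A.residualˡ s)
      (inj₂ z) s → lift-ᴮᴬ (subst (_≤ inj₁ y) (prodᴬᴮ-≢⊥ x≢⊥ z) s)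
    where
    lift-ᴮᴬ : ∀ {z} → inj₂ z ≤ inj₁ y → inj₂ z ≤ inj₁ (x A.⇒ y)
    lift-ᴮᴬ ()
  res-ᴬ x (inj₂ y) | no  x≢⊥ =
    subst (_≤ inj₂ y) (sym (prodᴬᴮ-≢⊥ x≢⊥ y)) (≤ᴮ B.≤-refl) , λ where
      (inj₁ z) (⊥≤ s)  → ⊥≤ (factor-⊥ x≢⊥ s)
      (inj₁ z) (≤↑e s) → ≤↑e s
      (inj₂ z) s → subst (_≤ inj₂ y) (prodᴬᴮ-≢⊥ x≢⊥ z) s

  res-ᴮᴬ : ∀ x y z → prodᴬᴮ z x ≤ inj₁ y → z ≡ A.bot
  res-ᴮᴬ x y z s with z A.≟ A.bot
  res-ᴮᴬ x y z s  | yes z≡⊥ = z≡⊥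
  res-ᴮᴬ x y z () | no  _

  res-ᴮᴮ : ∀ x y z → prodᴬᴮ z x ≤ inj₂ y → inj₁ z ≤ inj₂ (x B.⇒ y)
  res-ᴮᴮ x y z s with z A.≟ A.bot
  res-ᴮᴮ x y z s      | yes z≡⊥ = ⊥≤ z≡⊥
  res-ᴮᴮ x y z (≤ᴮ s) | no  _   =
    ≤↑e (B.residualˡ (subst (B._≤ y) (sym (B.identityʳ x)) s))

  ⇒-residual : Residual _≤_ _·_ _⇒_
  ⇒-residual (inj₁ x) y        = res-ᴬ x y
  ⇒-residual (inj₂ x) (inj₁ y) =
    subst (_≤ inj₁ y) (sym (prodᴬᴮ-⊥ refl x)) (⊥-least refl _) , λ where
      (inj₁ z) s → ⊥-least (res-ᴮᴬ x y z s) _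
  ⇒-residual (inj₂ x) (inj₂ y) =
    ≤ᴮ (B.residualʳ B.≤-refl) , λ where
      (inj₁ z) s      → res-ᴮᴮ x y z s
      (inj₂ z) (≤ᴮ s) → ≤ᴮ (B.residualˡ s)

infix  6 _©_
infix  4 _≅_

_©_ : FiniteConservativeCRL a → FiniteConservativeCRL a → RawResiduatedLattice a
𝐀 © 𝐁 = record { CatalanSum 𝐀 𝐁 }

𝟙 : RawResiduatedLattice a
𝟙 = record
  { Carrier = ⊤
  ; _∧_     = λ _ _ → tt
  ; _∨_     = λ _ _ → tt
  ; _·_     = λ _ _ → tt
  ; _⇒_     = λ _ _ → tt
  ; e       = tt
  }

-- _©_ is only defined on finite conservative commutative residuated lattices,
-- so the summands of a Catalan sum come with the proof that they are such; that
-- 𝐀 © 𝐁 is again one is not part of the definition.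
data Catalan {a} : RawResiduatedLattice a → Set (suc a) where
  one : Catalan 𝟙
  sum : ∀ (𝐀 𝐁 : FiniteConservativeCRL a) →
        Catalan (FiniteConservativeCRL.raw 𝐀) →
        Catalan (FiniteConservativeCRL.raw 𝐁) →
        Catalan (𝐀 © 𝐁)
  iso : ∀ {A B} → A ≅ B → Catalan A → Catalan B

{-# OPTIONS --safe #-}
module Submission where

-- Let 𝐂 be nontrivial and let k be the ⊑-least element other than ⊥.  Then
-- 𝐂 ≅ 𝐀 © 𝐁, where 𝐁 is the filter of all x with k ≤ x, with identity e ∨ k,
-- and 𝐀 is its complement.  The key observation is that b ⊑ a for b ∈ 𝐁 and
-- a ∈ 𝐀 ∖ {⊥}: otherwise b · a ≡ a, so that k ≡ k · a ≤ b · a ≡ a.  It makes 𝐀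
-- closed under joins, since a ∨ a′ ∈ 𝐁 would give a ∨ a′ ≡ a · (a ∨ a′) ≡
-- a ∨ a · a′, which is a when a ⊑ a′; and it gives a ≤ e ∨ k, since
-- e ∨ k ≡ a · (e ∨ k) ≡ a ∨ k.  Both parts are smaller than 𝐂 because bot ∉ 𝐁
-- and k ∉ 𝐀.

open import Defs
open import Algebra.Core using (Op₂)
open import Algebra.Definitions using (Selective; LeftIdentity)
import Algebra.Lattice.Morphism.LatticeMonomorphism as LatticeMonomorphism
open import Algebra.Lattice.Morphism.Structures using (IsLatticeMonomorphism)
import Algebra.Morphism.MagmaMonomorphism as MagmaMonomorphism
open import Algebra.Morphism.Definitions using (Homomorphic₂)
open import Algebra.Morphism.Structures using (IsMagmaMonomorphism)
open import Data.Fin.Base using (Fin; zero; suc; punchOut)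
open import Data.Fin.Properties using (+↔⊎; injective⇒≤; punchOut-injective)
open import Data.Irrelevant as Irrelevant using ([_])
open import Data.Nat.Base using (ℕ; zero; suc; _<_; s≤s)
open import Data.Nat.Properties using (<-≤-trans; ≤-pred; n<1+n)
open import Data.Product.Base using (∃; _×_; _,_; proj₁; proj₂)
open import Data.Refinement using (Refinement; value; proof; _,_; value-injective)
open import Data.Sum.Base as Sum using (inj₁; inj₂; [_,_]′)
open import Data.Sum.Function.Propositional using (_⊎-↔_)
open import Data.Unit.Polymorphic.Base using (tt)
open import Function.Base using (_∘_; flip)
open import Function.Bundles using (_↔_; _⇔_; Injection; mk⇔; mk↔ₛ′; Inverse; Equivalence)
open import Function.Construct.Composition using (_↔-∘_)
open import Function.Definitions using (Injective)
open import Function.Properties.Inverse using (↔-sym; Inverse⇒Injection)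
open import Level using (Level)
open import Relation.Binary.Core using (Rel)
import Relation.Binary.Construct.NaturalOrder.Left as NaturalOrder
open import Relation.Binary.Definitions using (Antisymmetric; Reflexive; Transitive)
import Relation.Binary.Lattice as OrderLattice
import Relation.Binary.Lattice.Properties.Lattice as OrderLatticeProperties
import Relation.Binary.Lattice.Properties.MeetSemilattice as MeetSemilatticeProperties
open import Relation.Binary.PropositionalEquality
  using (_≡_; _≢_; refl; sym; trans; cong; cong₂; subst; subst₂; isEquivalence; isMagma;
         module ≡-Reasoning)
open import Relation.Binary.Structures using (IsPartialOrder)
open import Relation.Nullary using (¬_; Dec; yes; no; contradiction; contradiction-irr; ¬?)
open import Relation.Nullary.Decidable using (recompute)
open import Relation.Unary using (Pred; Decidable)

private
  variable
    a p r : Level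
    m n : ℕ

↔-injective : ∀ {b} {A : Set a} {B : Set b} (f : A ↔ B) → Injective _≡_ _≡_ (Inverse.to f)
↔-injective = Injection.injective ∘ Inverse⇒Injection

-- Finite sets

-- Punching the missed value `i` out of the codomain leaves an injection into a set with one element
-- less.
injective-missing⇒< : ∀ {f : Fin m → Fin n} → Injective _≡_ _≡_ f →
                      ∀ i → (∀ j → i ≢ f j) → m < n
injective-missing⇒< {n = suc n} f-inj i missing =
  s≤s (injective⇒≤ {f = λ j → punchOut (missing j)}
    (λ eq → f-inj (punchOut-injective (missing _) (missing _) eq)))

-- A `Refinement` holds its membership proof irrelevantly, so elements with equal values are equal
-- and each index satisfying `P` is counted exactly once.
refinement-Fin : ∀ n {P : Pred (Fin n) p} → Decidable P →
                 ∃ λ m → Refinement (Fin n) P ↔ Fin m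
refinement-Fin zero    P? = 0 , mk↔ₛ′ (λ ()) (λ ()) (λ ()) (λ ())
refinement-Fin (suc n) {P} P? with P? zero | refinement-Fin n (P? ∘ suc)
... | yes p₀ | m , R = suc m , mk↔ₛ′ f g fg gf
  where
  open Inverse R
  f : Refinement (Fin (suc n)) P → Fin (suc m)
  f (zero  , _) = zero
  f (suc i , p) = suc (to (i , p))
  g : Fin (suc m) → Refinement (Fin (suc n)) P
  g zero    = zero , [ p₀ ]
  g (suc j) = suc (value (from j)) , proof (from j)
  fg : ∀ j → f (g j) ≡ j
  fg zero    = refl
  fg (suc j) = cong suc (strictlyInverseˡ j)
  gf : ∀ x → g (f x) ≡ x
  gf (zero  , _) = refl
  gf (suc i , p) = value-injective (cong (suc ∘ value) (strictlyInverseʳ (i , p)))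
... | no ¬p₀ | m , R = m , mk↔ₛ′ f g strictlyInverseˡ gf
  where
  open Inverse R
  f : Refinement (Fin (suc n)) P → Fin m
  f (zero  , [ p ]) = contradiction-irr p ¬p₀
  f (suc i , p) = to (i , p)
  g : Fin m → Refinement (Fin (suc n)) P
  g j = suc (value (from j)) , proof (from j)
  gf : ∀ x → g (f x) ≡ x
  gf (zero  , [ p ]) = contradiction-irr p ¬p₀
  gf (suc i , p) = value-injective (cong (suc ∘ value) (strictlyInverseʳ (i , p)))

module _ {A : Set a} {P : Pred A p} (P? : Decidable P) where

  refinement-finite : (∃ λ n → A ↔ Fin n) → ∃ λ m → Refinement A P ↔ Fin m
  refinement-finite (n , A↔Fin) =
    let m , R = refinement-Fin n (P? ∘ from) in m , (R ↔-∘ transfer)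
    where
    open Inverse A↔Fin
    transfer : Refinement A P ↔ Refinement (Fin n) (P ∘ from)
    transfer = mk↔ₛ′
      (λ (x , q) → to x , Irrelevant.map (subst P (sym (strictlyInverseʳ x))) q)
      (λ (i , q) → from i , q)
      (λ (i , _) → value-injective (strictlyInverseˡ i))
      (λ (x , _) → value-injective (strictlyInverseʳ x))

  -- Enumerating the refinement, forgetting the proof and indexing in `A` is an injection that
  -- misses the index of `x`. The strict drop drives the induction on size.
  refinement-size : (fin : ∃ λ n → A ↔ Fin n) → ∀ {x} → ¬ P x →
                    proj₁ (refinement-finite fin) < proj₁ fin
  refinement-size fin {x} ¬Px =
    injective-missing⇒< {f = to ∘ value ∘ Sub.from}
      (λ eq → ↔-injective (↔-sym R) (value-injective (↔-injective (proj₂ fin) eq)))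
      (to x) (λ j eq → excluded (Sub.from j) (↔-injective (proj₂ fin) eq))
    where
    open Inverse (proj₂ fin)
    R = proj₂ (refinement-finite fin)
    module Sub = Inverse R
    excluded : ∀ (s : Refinement A P) → x ≢ value s
    excluded (_ , [ q ]) refl = contradiction-irr q ¬Px

  -- A lower bound within `P` is carried along the enumeration, starting from `x₀` and skipping
  -- elements outside `P`. It is used for `⊑`, to find `k`, and for the reversed lattice order, to
  -- find the largest element of 𝐀.
  directed⇒minimum : (∃ λ n → A ↔ Fin n) → {_R_ : Rel A r} → Transitive _R_ →
    (∀ {x y} → P x → P y → ∃ λ z → P z × z R x × z R y) →
    ∃ P → ∃ λ z → P z × (∀ {x} → P x → z R x)
  directed⇒minimum (n , A↔Fin) {_R_} R-trans directed (x₀ , Px₀) =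
    let z , Pz , z≤ = bound n from in
    z , Pz , λ {x} Px → subst (z R_) (strictlyInverseʳ x)
                          (z≤ (to x) (subst P (sym (strictlyInverseʳ x)) Px))
    where
    open Inverse A↔Fin
    bound : ∀ n (f : Fin n → A) → ∃ λ z → P z × (∀ i → P (f i) → z R f i)
    bound zero    f = x₀ , Px₀ , λ ()
    bound (suc n) f with P? (f zero) | bound n (f ∘ suc)
    ... | no ¬q | z , Pz , z≤ = z , Pz , λ where
      zero    q → contradiction q ¬q
      (suc i) q → z≤ i q
    ... | yes q | z , Pz , z≤ =
      let w , Pw , w≤f₀ , w≤z = directed q Pz in w , Pw , λ where
        zero    _ → w≤f₀
        (suc i) q → R-trans w≤z (z≤ i q)

-- Residuated lattices

module _ {A : Set a} {_≤_ : Rel A r} {_∧_ : Op₂ A}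
         (≤-refl : Reflexive _≤_) (antisym : Antisymmetric _≡_ _≤_)
         (∧-infimum : OrderLattice.Infimum _≤_ _∧_) where

  -- This links the orders given as data types on a Catalan sum to the equational orders of a raw
  -- algebra.
  infimum⇒natural : ∀ {x y} → (x ≤ y) ⇔ (x ≡ x ∧ y)
  infimum⇒natural {x} {y} =
    let x∧y≤x , x∧y≤y , greatest = ∧-infimum x y in
    mk⇔ (λ x≤y → antisym (greatest x ≤-refl x≤y) x∧y≤x)
        (λ eq → subst (_≤ y) (sym eq) x∧y≤y)

module PropertiesExtra (𝐀 : FiniteConservativeCRL a) where
  open Properties 𝐀

  -- A product is one of its factors, so it never leaves a subset. Both parts of the decomposition
  -- get their closure under `·` from here.
  selective-closed : {P : Pred Carrier p} → ∀ {x y} → P x → P y → P (x · y)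
  selective-closed {P = P} {x} {y} Px Py with conservative x y
  ... | inj₁ eq = subst P (sym eq) Px
  ... | inj₂ eq = subst P (sym eq) Py

  ⊑-trans : Transitive _⊑_
  ⊑-trans = NaturalOrder.trans _≡_ _·_ isSemigroup

  x≤x∨y : ∀ {x y} → x ≤ x ∨ y
  x≤x∨y = proj₁ (supremum _ _)

  y≤x∨y : ∀ {x y} → y ≤ x ∨ y
  y≤x∨y = proj₁ (proj₂ (supremum _ _))

  ∨-least : ∀ {x y z} → x ≤ z → y ≤ z → x ∨ y ≤ z
  ∨-least = proj₂ (proj₂ (supremum _ _)) _

  x≤y⇒x∨y≡y : ∀ {x y} → x ≤ y → x ∨ y ≡ y
  x≤y⇒x∨y≡y x≤y = antisym (∨-least x≤y ≤-refl) y≤x∨y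

  y≤x⇒x∨y≡x : ∀ {x y} → y ≤ x → x ∨ y ≡ x
  y≤x⇒x∨y≡x y≤x = antisym (∨-least ≤-refl y≤x) x≤x∨y

  ≤bot : ∀ {x} → x ≤ bot → x ≡ bot
  ≤bot x≤⊥ = antisym x≤⊥ (bot-minimum _)

  ·-monoʳ : ∀ x {y z} → y ≤ z → x · y ≤ x · z
  ·-monoʳ x y≤z = residualʳ (≤-trans y≤z (residualˡ ≤-refl))

  ·-monoˡ : ∀ x {y z} → y ≤ z → y · x ≤ z · x
  ·-monoˡ x y≤z = subst₂ _≤_ (comm x _) (comm x _) (·-monoʳ x y≤z)

  -- Multiplication by `x` is a left adjoint, with right adjoint `x ⇒_`, and so preserves joins.
  ·-distribˡ-∨ : ∀ x y z → x · (y ∨ z) ≡ (x · y) ∨ (x · z)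
  ·-distribˡ-∨ x y z = antisym
    (residualʳ (∨-least (residualˡ x≤x∨y) (residualˡ y≤x∨y)))
    (∨-least (·-monoʳ x x≤x∨y) (·-monoʳ x y≤x∨y))

module _ {A B : RawResiduatedLattice a} where
  private
    module A = RawResiduatedLattice A
    module B = RawResiduatedLattice B

  -- The conditions on `e` and `⇒` ask only that they act as identity and residual on the image. An
  -- inclusion need not preserve them: the filter 𝐁 has identity `e ∨ k`, and the residual of 𝐀
  -- differs from that of 𝐂 at bottom.
  pullback : (f : B.Carrier → A.Carrier) → Injective _≡_ _≡_ f →
             Homomorphic₂ B.Carrier A.Carrier _≡_ f B._∧_ A._∧_ →
             Homomorphic₂ B.Carrier A.Carrier _≡_ f B._∨_ A._∨_ →
             Homomorphic₂ B.Carrier A.Carrier _≡_ f B._·_ A._·_ →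
             (∀ x → f B.e A.· f x ≡ f x) →
             (∀ x y z → (f x A.· f y A.≤ f z) ⇔ (f y A.≤ f (x B.⇒ z))) →
             Finite B → IsFiniteConservativeCRL A → IsFiniteConservativeCRL B
  pullback f f-inj ∧-homo ∨-homo ·-homo identity residual B-finite A-fccrl = record
    { isCommutativeResiduatedLattice = record
      { isLattice           = LatticeMonomorphism.isLattice lattice-mono AP.isLattice
      ; isCommutativeMonoid = record
        { isMonoid = record
          { isSemigroup = record
            { isMagma = isMagma B._·_
            ; assoc   = M.assoc (isMagma A._·_) AP.assoc
            }
          ; identity = ·-identityˡ , λ x → trans (·-comm x B.e) (·-identityˡ x)
          }
        ; comm = ·-comm
        }
      ; residuation = λ x y z → mk⇔
          (λ xy≤z → reflect (Equivalence.to (residual x y z)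
                      (subst (A._≤ f z) (·-homo x y) (preserve xy≤z))))
          (λ y≤x⇒z → reflect (subst (A._≤ f z) (sym (·-homo x y))
                       (Equivalence.from (residual x y z) (preserve y≤x⇒z))))
      }
    ; conservative = M.sel (isMagma A._·_) AP.conservative
    ; finite       = B-finite
    }
    where
    𝐀 : FiniteConservativeCRL a
    𝐀 = record { isFiniteConservativeCRL = A-fccrl }
    module AP = Properties 𝐀
    lattice-mono : IsLatticeMonomorphism
      (record { _≈_ = _≡_ ; _∧_ = B._∧_ ; _∨_ = B._∨_ })
      (record { _≈_ = _≡_ ; _∧_ = A._∧_ ; _∨_ = A._∨_ }) f
    lattice-mono = record
      { isLatticeHomomorphism = record
        { isRelHomomorphism = record { cong = cong f }
        ; ∧-homo = ∧-homo
        ; ∨-homo = ∨-homo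
        }
      ; injective = f-inj
      }
    ·-mono : IsMagmaMonomorphism
      (record { _≈_ = _≡_ ; _∙_ = B._·_ }) (record { _≈_ = _≡_ ; _∙_ = A._·_ }) f
    ·-mono = record
      { isMagmaHomomorphism = record
        { isRelHomomorphism = record { cong = cong f } ; homo = ·-homo }
      ; injective = f-inj
      }
    module M = MagmaMonomorphism ·-mono
    ·-comm = M.comm (isMagma A._·_) AP.comm
    ·-identityˡ : LeftIdentity _≡_ B.e B._·_
    ·-identityˡ x = f-inj (trans (·-homo B.e x) (identity x))
    preserve : ∀ {x y} → x B.≤ y → f x A.≤ f y
    preserve x≤y = trans (cong f x≤y) (∧-homo _ _)
    reflect : ∀ {x y} → f x A.≤ f y → x B.≤ y
    reflect fx≤fy = f-inj (trans fx≤fy (sym (∧-homo _ _)))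

  ≅-preserves : A ≅ B → IsFiniteConservativeCRL A → IsFiniteConservativeCRL B
  ≅-preserves A≅B A-fccrl =
    pullback from (↔-injective (↔-sym bijection))
      (from-homo A._∧_ B._∧_ ∧-homo) (from-homo A._∨_ B._∨_ ∨-homo)
      (from-homo A._·_ B._·_ ·-homo)
      (λ x → trans (cong (A._· from x) from-e) (AP.identityˡ (from x)))
      (λ x y z → subst (λ w → (from x A.· from y A.≤ from z) ⇔ (from y A.≤ w))
                   (sym (from-homo A._⇒_ B._⇒_ ⇒-homo x z)) (AP.residuation _ _ _))
      (proj₁ AP.finite , (proj₂ AP.finite ↔-∘ ↔-sym bijection))
      A-fccrl
    where
    open _≅_ A≅B
    open Inverse bijection using (strictlyInverseˡ; strictlyInverseʳ)
    𝐀 : FiniteConservativeCRL a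
    𝐀 = record { isFiniteConservativeCRL = A-fccrl }
    module AP = Properties 𝐀
    from-homo : ∀ (_∙_ : Op₂ A.Carrier) (_∘_ : Op₂ B.Carrier) →
                Homomorphic₂ A.Carrier B.Carrier _≡_ to _∙_ _∘_ →
                Homomorphic₂ B.Carrier A.Carrier _≡_ from _∘_ _∙_
    from-homo _∙_ _∘_ homo x y = trans
      (cong from (cong₂ _∘_ (sym (strictlyInverseˡ x)) (sym (strictlyInverseˡ y))))
      (trans (cong from (sym (homo (from x) (from y)))) (strictlyInverseʳ _))
    from-e : from B.e ≡ A.e
    from-e = trans (cong from (sym e-homo)) (strictlyInverseʳ A.e)

-- The remaining operations are determined by the lattice order and the product.
module _ (𝐀 𝐁 : FiniteConservativeCRL a) where
  private
    module A where
      open Properties 𝐀 public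
      open PropertiesExtra 𝐀 public
    module B where
      open Properties 𝐁 public
      open PropertiesExtra 𝐁 public

  order-product-iso : (f : A.Carrier ↔ B.Carrier) → let to = Inverse.to f in
                      (∀ {x y} → x A.≤ y → to x B.≤ to y) →
                      (∀ {x y} → to x B.≤ to y → x A.≤ y) →
                      Homomorphic₂ A.Carrier B.Carrier _≡_ to A._·_ B._·_ →
                      A.raw ≅ B.raw
  order-product-iso f preserve reflect ·-homo = record
    { bijection = f
    ; ∧-homo = λ x y →
        let p , q , _ = A.infimum x y
            s , t , g = B.infimum (to x) (to y) in
        B.antisym (g _ (preserve p) (preserve q))
                  (adjʳ (proj₂ (proj₂ (A.infimum x y)) _ (adjˡ s) (adjˡ t)))
    ; ∨-homo = λ x y →
        B.antisym (adjˡ′ (A.∨-least (adjʳ′ B.x≤x∨y) (adjʳ′ B.y≤x∨y)))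
                  (B.∨-least (preserve A.x≤x∨y) (preserve A.y≤x∨y))
    ; ·-homo = ·-homo
    ; ⇒-homo = λ x y →
        B.antisym
          (B.residualˡ (subst (B._≤ to y) (·-homo x _) (preserve (A.residualʳ A.≤-refl))))
          (adjʳ (A.residualˡ (reflect (subst (B._≤ to y)
            (sym (trans (·-homo x _) (cong (to x B.·_) (strictlyInverseˡ _))))
            (B.residualʳ B.≤-refl)))))
    ; e-homo = begin
        -- Since `to` is onto, `to A.e` acts as an identity on `B.e`, which forces the two to agree.
        to A.e                   ≡⟨ B.identityʳ _ ⟨
        to A.e B.· B.e           ≡⟨ cong (to A.e B.·_) (strictlyInverseˡ B.e) ⟨
        to A.e B.· to (from B.e) ≡⟨ ·-homo A.e (from B.e) ⟨
        to (A.e A.· from B.e)    ≡⟨ cong to (A.identityˡ _) ⟩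
        to (from B.e)            ≡⟨ strictlyInverseˡ B.e ⟩
        B.e                      ∎
    }
    where
    open Inverse f
    open ≡-Reasoning
    adjˡ : ∀ {x y} → y B.≤ to x → from y A.≤ x
    adjˡ y≤ = reflect (subst (B._≤ _) (sym (strictlyInverseˡ _)) y≤)
    adjʳ : ∀ {x y} → from y A.≤ x → y B.≤ to x
    adjʳ ≤x = subst (B._≤ _) (strictlyInverseˡ _) (preserve ≤x)
    adjʳ′ : ∀ {x y} → to x B.≤ y → x A.≤ from y
    adjʳ′ ≤y = reflect (subst (_ B.≤_) (sym (strictlyInverseˡ _)) ≤y)
    adjˡ′ : ∀ {x y} → x A.≤ from y → to x B.≤ y
    adjˡ′ x≤ = subst (_ B.≤_) (strictlyInverseˡ _) (preserve x≤)

-- Catalan sums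

module CatalanSumProperties (𝐀 𝐁 : FiniteConservativeCRL a) where
  open CatalanSum 𝐀 𝐁 public
  private
    module A where
      open Properties 𝐀 public
      open PropertiesExtra 𝐀 public
    module B where
      open Properties 𝐁 public
      open PropertiesExtra 𝐁 public
    module Raw = RawResiduatedLattice (𝐀 © 𝐁)

  ≤-refl : Reflexive _≤_
  ≤-refl {inj₁ _} = ≤ᴬ A.≤-refl
  ≤-refl {inj₂ _} = ≤ᴮ B.≤-refl

  ≤-trans : Transitive _≤_
  ≤-trans (≤ᴬ p)    (≤ᴬ q)    = ≤ᴬ (A.≤-trans p q)
  ≤-trans (≤ᴬ p)    (⊥≤ refl) = ⊥≤ (A.≤bot p)
  ≤-trans (≤ᴬ _)    (≤↑e q)   = ≤↑e q
  ≤-trans (≤ᴮ p)    (≤ᴮ q)    = ≤ᴮ (B.≤-trans p q)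
  ≤-trans (⊥≤ p)    (≤ᴮ _)    = ⊥≤ p
  ≤-trans (≤↑e p)   (≤ᴮ q)    = ≤↑e (B.≤-trans p q)

  ≤-antisym : Antisymmetric _≡_ _≤_
  ≤-antisym (≤ᴬ p) (≤ᴬ q) = cong inj₁ (A.antisym p q)
  ≤-antisym (≤ᴮ p) (≤ᴮ q) = cong inj₂ (B.antisym p q)

  ⊑-refl : Reflexive _⊑_
  ⊑-refl {inj₁ x} = ⊑ᴬ (A.⊑-refl x)
  ⊑-refl {inj₂ x} = ⊑ᴮ (B.⊑-refl x)

  ⊑-trans : Transitive _⊑_
  ⊑-trans (⊑ᴬ p)    (⊑ᴬ q)  = ⊑ᴬ (A.⊑-trans p q)
  ⊑-trans (⊑ᴬ p)    (⊥⊑ q)  = ⊥⊑ (⊑⊥ p q)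
  ⊑-trans (⊑ᴮ p)    (⊑ᴮ q)  = ⊑ᴮ (B.⊑-trans p q)
  ⊑-trans (⊑ᴮ _)    (⊑∖⊥ q) = ⊑∖⊥ q
  ⊑-trans (⊥⊑ p)    (⊑ᴮ _)  = ⊥⊑ p
  ⊑-trans (⊥⊑ refl) (⊑∖⊥ _) = ⊑ᴬ (sym (A.bot-zeroˡ _))
  ⊑-trans (⊑∖⊥ p)   (⊑ᴬ q)  = ⊑∖⊥ (p ∘ ⊑⊥ q)
  ⊑-trans (⊑∖⊥ p)   (⊥⊑ q)  = contradiction q p

  ⊑-antisym : Antisymmetric _≡_ _⊑_
  ⊑-antisym (⊑ᴬ p)  (⊑ᴬ q)  = cong inj₁ (trans p (trans (A.comm _ _) (sym q)))
  ⊑-antisym (⊑ᴮ p)  (⊑ᴮ q)  = cong inj₂ (trans p (trans (B.comm _ _) (sym q)))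
  ⊑-antisym (⊥⊑ p)  (⊑∖⊥ q) = contradiction p q
  ⊑-antisym (⊑∖⊥ p) (⊥⊑ q)  = contradiction q p

  ≤⇔≤ : ∀ {x y} → (x ≤ y) ⇔ (x Raw.≤ y)
  ≤⇔≤ = infimum⇒natural ≤-refl ≤-antisym ∧-infimum

  -- Monotonicity yields the half of residuation that `⇒-residual` does not state. In the mixed
  -- cases, a nonbottom element of 𝐀 fixes every element of 𝐁 under the product, while bottom
  -- absorbs it.
  ·-monoʳ : ∀ x {y z} → y ≤ z → x · y ≤ x · z
  ·-monoʳ (inj₁ x) (≤ᴬ p) = ≤ᴬ (A.·-monoʳ x p)
  ·-monoʳ (inj₁ x) (≤ᴮ p) with x A.≟ A.bot
  ... | yes _ = ≤-refl
  ... | no  _ = ≤ᴮ p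
  ·-monoʳ (inj₁ x) (⊥≤ refl) = ⊥-least (A.bot-zeroʳ x) _
  ·-monoʳ (inj₁ x) (≤↑e p) with x A.≟ A.bot
  ... | yes refl = ⊥-least (A.bot-zeroˡ _) _
  ... | no  _    = ≤↑e p
  ·-monoʳ (inj₂ x) (≤ᴬ {y} {z} p) with y A.≟ A.bot | z A.≟ A.bot
  ... | yes y≡⊥ | _        = ⊥-least y≡⊥ _
  ... | no  y≢⊥ | yes refl = contradiction (A.≤bot p) y≢⊥
  ... | no  _   | no  _    = ≤-refl
  ·-monoʳ (inj₂ x) (≤ᴮ p) = ≤ᴮ (B.·-monoʳ x p)
  ·-monoʳ (inj₂ x) (⊥≤ refl) =
    subst (_≤ _) (sym (prodᴬᴮ-⊥ refl x)) (⊥-least refl _)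
  ·-monoʳ (inj₂ x) (≤↑e {y} {z} p) with y A.≟ A.bot
  ... | yes y≡⊥ = ⊥-least y≡⊥ _
  -- The left product is `inj₂ x`, and `x ≡ x · e ≤ x · z` because `z` lies above the identity of 𝐁.
  ... | no  _   = ≤ᴮ (subst (B._≤ (x B.· z)) (B.identityʳ x) (B.·-monoʳ x p))

  ·-conservative : Selective _≡_ _·_
  ·-conservative (inj₁ x) (inj₁ y) = Sum.map (cong inj₁) (cong inj₁) (A.conservative x y)
  ·-conservative (inj₁ x) (inj₂ y) with x A.≟ A.bot
  ... | yes _ = inj₁ refl
  ... | no  _ = inj₂ refl
  ·-conservative (inj₂ x) (inj₁ y) with y A.≟ A.bot
  ... | yes _ = inj₂ refl
  ... | no  _ = inj₁ refl
  ·-conservative (inj₂ x) (inj₂ y) = Sum.map (cong inj₂) (cong inj₂) (B.conservative x y)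

  isFiniteConservativeCRL : IsFiniteConservativeCRL (𝐀 © 𝐁)
  isFiniteConservativeCRL = record
    { isCommutativeResiduatedLattice = record
      { isLattice = OrderLatticeProperties.isAlgLattice record
        { isLattice = record
          { isPartialOrder = isPartialOrder ≤-refl ≤-trans ≤-antisym
          ; supremum       = ∨-supremum
          ; infimum        = ∧-infimum
          }
        }
      ; isCommutativeMonoid = record
        { isMonoid = record
          -- The product is the meet for `⊑`, so the semigroup laws are those of a meet semilattice;
          -- the identity laws hold because `e` is the `⊑`-greatest element.
          { isSemigroup = record { isMagma = isMagma _·_ ; assoc = Meet.∧-assoc }
          ; identity    = (λ x → trans (Meet.∧-comm e x) (identityʳ x)) , identityʳ
          }
        ; comm = Meet.∧-comm
        }
      ; residuation = λ x y z →
          let xr≤z , greatest = ⇒-residual x z in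
          mk⇔ (λ xy≤z → to ≤⇔≤ (greatest y (from ≤⇔≤ xy≤z)))
              (λ y≤r → to ≤⇔≤ (≤-trans (·-monoʳ x (from ≤⇔≤ y≤r)) xr≤z))
      }
    ; conservative = ·-conservative
    ; finite       = _ , ↔-sym +↔⊎ ↔-∘ (proj₂ A.finite ⊎-↔ proj₂ B.finite)
    }
    where
    open Equivalence
    isPartialOrder : ∀ {_≲_ : Rel Carrier _} → Reflexive _≲_ → Transitive _≲_ →
                     Antisymmetric _≡_ _≲_ → IsPartialOrder _≡_ _≲_
    isPartialOrder ≲-refl ≲-trans ≲-antisym = record
      { isPreorder = record
        { isEquivalence = isEquivalence
        ; reflexive     = λ { refl → ≲-refl }
        ; trans         = ≲-trans
        }
      ; antisym = ≲-antisym
      }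
    meetSemilattice : OrderLattice.MeetSemilattice _ _ _
    meetSemilattice = record
      { isMeetSemilattice = record
        { isPartialOrder = isPartialOrder ⊑-refl ⊑-trans ⊑-antisym
        ; infimum        = ·-infimum
        }
      }
    module Meet = MeetSemilatticeProperties meetSemilattice
    identityʳ : ∀ x → x · e ≡ x
    identityʳ x = sym (to (infimum⇒natural ⊑-refl ⊑-antisym ·-infimum) (e-maximum x))

  sum-crl : FiniteConservativeCRL a
  sum-crl = record { isFiniteConservativeCRL = isFiniteConservativeCRL }

-- Catalan algebras are finite conservative commutative residuated lattices

𝟙-isFiniteConservativeCRL : IsFiniteConservativeCRL {a} 𝟙
𝟙-isFiniteConservativeCRL = record
  { isCommutativeResiduatedLattice = record
    { isLattice = record
      { isEquivalence = isEquivalence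
      ; ∨-comm     = λ _ _ → refl
      ; ∨-assoc    = λ _ _ _ → refl
      ; ∨-cong     = λ _ _ → refl
      ; ∧-comm     = λ _ _ → refl
      ; ∧-assoc    = λ _ _ _ → refl
      ; ∧-cong     = λ _ _ → refl
      ; absorptive = (λ _ _ → refl) , (λ _ _ → refl)
      }
    ; isCommutativeMonoid = record
      { isMonoid = record
        { isSemigroup = record { isMagma = isMagma _ ; assoc = λ _ _ _ → refl }
        ; identity    = (λ _ → refl) , (λ _ → refl)
        }
      ; comm = λ _ _ → refl
      }
    ; residuation = λ _ _ _ → mk⇔ (λ _ → refl) (λ _ → refl)
    }
  ; conservative = λ _ _ → inj₁ refl
  ; finite       = 1 , mk↔ₛ′ (λ _ → zero) (λ _ → tt) (λ { zero → refl }) (λ _ → refl)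
  }

-- The summands of `sum` arrive with their own proofs of membership, so the recursion passes only
-- through `iso`.
catalan⇒finiteConservativeCRL : ∀ {A : RawResiduatedLattice a} →
                                Catalan A → IsFiniteConservativeCRL A
catalan⇒finiteConservativeCRL one           = 𝟙-isFiniteConservativeCRL
catalan⇒finiteConservativeCRL (sum 𝐀 𝐁 _ _) = CatalanSumProperties.isFiniteConservativeCRL 𝐀 𝐁
catalan⇒finiteConservativeCRL (iso A≅B c)   = ≅-preserves A≅B (catalan⇒finiteConservativeCRL c)

-- Decomposition

module _ (𝐂 : FiniteConservativeCRL a) where
  open Properties 𝐂

  module Restriction
    {P : Pred Carrier a} (P? : Decidable P)
    (∧-closed : ∀ {x y} → P x → P y → P (x ∧ y))
    (∨-closed : ∀ {x y} → P x → P y → P (x ∨ y))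
    (eᴾ : Refinement Carrier P)
    (identity : ∀ {x} → P x → value eᴾ · x ≡ x)
    (_⇒ᴾ_ : Op₂ (Refinement Carrier P))
    (residual : ∀ x (y : Refinement Carrier P) z → P (value y) →
      (value x · value y ≤ value z) ⇔ (value y ≤ value (x ⇒ᴾ z)))
    where

    holds : ∀ (x : Refinement Carrier P) → P (value x)
    holds (x , [ p ]) = recompute (P? x) p

    rawᴾ : RawResiduatedLattice a
    rawᴾ = record
      { Carrier = Refinement Carrier P
      ; _∧_     = λ (x , p) (y , q) → x ∧ y , Irrelevant.zipWith ∧-closed p q
      ; _∨_     = λ (x , p) (y , q) → x ∨ y , Irrelevant.zipWith ∨-closed p q
      ; _·_     = λ (x , p) (y , q) →
                    x · y , Irrelevant.zipWith (PropertiesExtra.selective-closed 𝐂 {P = P}) p q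
      ; _⇒_     = _⇒ᴾ_
      ; e       = eᴾ
      }

    restriction : FiniteConservativeCRL a
    restriction = record
      { raw = rawᴾ
      ; isFiniteConservativeCRL = pullback value value-injective
          (λ _ _ → refl) (λ _ _ → refl) (λ _ _ → refl)
          (λ x → identity (holds x)) (λ x y z → residual x y z (holds y))
          (refinement-finite P? finite) isFiniteConservativeCRL
      }

module Decomposition (𝐂 : FiniteConservativeCRL a)
                     (e≢⊥ : Properties.e 𝐂 ≢ Properties.bot 𝐂) where
  open Properties 𝐂
  open PropertiesExtra 𝐂

  private
    -- The product of two nonbottom elements is nonbottom and `⊑`-below both, which gives
    -- directedness; `e` shows that there is such an element.
    least-nonbottom : ∃ λ k → k ≢ bot × (∀ {x} → x ≢ bot → k ⊑ x)
    least-nonbottom = directed⇒minimum (λ x → ¬? (x ≟ bot)) finite ⊑-trans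
      (λ {x} {y} x≢⊥ y≢⊥ →
        let p , q , _ = ·-infimum x y in x · y , selective-closed {P = _≢ bot} x≢⊥ y≢⊥ , p , q)
      (e , e≢⊥)

  k : Carrier
  k = proj₁ least-nonbottom

  k≢⊥ : k ≢ bot
  k≢⊥ = proj₁ (proj₂ least-nonbottom)

  k⊑ : ∀ {x} → x ≢ bot → k ⊑ x
  k⊑ = proj₂ (proj₂ least-nonbottom)

  k≤⇒≢⊥ : ∀ {x} → k ≤ x → x ≢ bot
  k≤⇒≢⊥ k≤x refl = k≢⊥ (≤bot k≤x)

  k≰bot : ¬ k ≤ bot
  k≰bot k≤⊥ = k≤⇒≢⊥ k≤⊥ refl

  k≰⇒⊒ : ∀ {x y} → k ≤ x → ¬ k ≤ y → y ≢ bot → x · y ≡ x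
  k≰⇒⊒ {x} {y} k≤x k≰y y≢⊥ with conservative x y
  ... | inj₁ xy≡x = xy≡x
  ... | inj₂ xy≡y =
    contradiction (subst₂ _≤_ (sym (k⊑ y≢⊥)) xy≡y (·-monoˡ y k≤x)) k≰y

  k≰-∨-absorbing : ∀ {x y} → x ≢ bot → ¬ k ≤ x → x · y ≡ x → ¬ k ≤ x ∨ y
  k≰-∨-absorbing {x} {y} x≢⊥ k≰x xy≡x k≤x∨y = k≰x (subst (k ≤_) x∨y≡x k≤x∨y)
    where
    open ≡-Reasoning
    x∨y≡x : x ∨ y ≡ x
    x∨y≡x = begin
      -- The join is assumed to lie above `k`, so the key observation `k≰⇒⊒` lets it absorb `x`.
      x ∨ y             ≡⟨ k≰⇒⊒ k≤x∨y k≰x x≢⊥ ⟨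
      (x ∨ y) · x       ≡⟨ comm _ _ ⟩
      x · (x ∨ y)       ≡⟨ ·-distribˡ-∨ x x y ⟩
      (x · x) ∨ (x · y) ≡⟨ cong₂ _∨_ (·-idem x) xy≡x ⟩
      x ∨ x             ≡⟨ x≤y⇒x∨y≡y ≤-refl ⟩
      x                 ∎

  -- Conservativity says which of the two absorbs the other, and `k≰-∨-absorbing` applies to that
  -- one. Bottom is split off because the key observation concerns nonbottom elements.
  k≰-∨ : ∀ {x y} → ¬ k ≤ x → ¬ k ≤ y → ¬ k ≤ x ∨ y
  k≰-∨ {x} {y} k≰x k≰y with x ≟ bot | y ≟ bot | conservative x y
  ... | yes refl | _        | _ = k≰y ∘ subst (k ≤_) (x≤y⇒x∨y≡y (bot-minimum y))
  ... | no _     | yes refl | _ = k≰x ∘ subst (k ≤_) (y≤x⇒x∨y≡x (bot-minimum x))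
  ... | no x≢⊥   | no _     | inj₁ xy≡x = k≰-∨-absorbing x≢⊥ k≰x xy≡x
  ... | no _     | no y≢⊥   | inj₂ xy≡y =
    -- The roles are exchanged here; the `antisym` term is commutativity of the join.
    k≰-∨-absorbing y≢⊥ k≰y (trans (comm y x) xy≡y) ∘ subst (k ≤_) (antisym
      (∨-least y≤x∨y x≤x∨y) (∨-least y≤x∨y x≤x∨y))

  -- The filter of elements above `k`

  module Upper where
    -- The identity `e` may lie outside the filter. Joining it with `k` brings it in and adds only
    -- `x · k ≡ k`, which is below `x`.
    identity : ∀ {x} → k ≤ x → (e ∨ k) · x ≡ x
    identity {x} k≤x = begin
      (e ∨ k) · x       ≡⟨ comm _ _ ⟩
      x · (e ∨ k)       ≡⟨ ·-distribˡ-∨ x e k ⟩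
      (x · e) ∨ (x · k) ≡⟨ cong₂ _∨_ (identityʳ x) (trans (comm x k) (sym (k⊑ (k≤⇒≢⊥ k≤x)))) ⟩
      x ∨ k             ≡⟨ y≤x⇒x∨y≡x k≤x ⟩
      x                 ∎
      where open ≡-Reasoning

    -- As `x · k ≡ k` for nonbottom `x`, residuation makes `k ≤ x ⇒ y` equivalent to `k ≤ y`. The
    -- lower part uses the same equivalence in the other direction.
    ⇒-closed : ∀ {x y} → k ≤ x → k ≤ y → k ≤ x ⇒ y
    ⇒-closed {x} {y} k≤x k≤y =
      residualˡ (subst (_≤ y) (trans (k⊑ (k≤⇒≢⊥ k≤x)) (comm k x)) k≤y)

    open Restriction 𝐂 (k ≤?_)
      (λ k≤x k≤y → proj₂ (proj₂ (infimum _ _)) k k≤x k≤y)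
      (λ k≤x _ → ≤-trans k≤x x≤x∨y)
      (e ∨ k , [ y≤x∨y ]) identity
      (λ (x , p) (y , q) → x ⇒ y , Irrelevant.zipWith ⇒-closed p q)
      (λ x y z _ → residuation _ _ _) public

  -- The complement of the filter

  module Lower where
    k≰? : Decidable (λ x → ¬ k ≤ x)
    k≰? x = ¬? (k ≤? x)

    private
      -- Closure under joins makes the lower part directed for the reversed order, and it contains
      -- `bot`.
      greatest : ∃ λ t → ¬ k ≤ t × (∀ {x} → ¬ k ≤ x → x ≤ t)
      greatest = directed⇒minimum k≰? finite (flip ≤-trans)
        (λ p q → _ , k≰-∨ p q , x≤x∨y , y≤x∨y) (bot , k≰bot)

    -- k ≤ e happens only when 𝐀 = {⊥}.
    unit : Refinement Carrier (λ x → ¬ k ≤ x)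
    unit with k ≤? e
    ... | yes _   = bot , [ k≰bot ]
    ... | no  k≰e = e , [ k≰e ]

    identity : ∀ {x} → ¬ k ≤ x → value unit · x ≡ x
    identity {x} k≰x with k ≤? e
    ... | no  _   = identityˡ x
    ... | yes k≤e with x ≟ bot
    ...   | yes refl = bot-zeroˡ bot
    -- The key observation gives `e · x ≡ e`, hence `x ≡ e`, so `x` would lie above `k`.
    ...   | no  x≢⊥  = contradiction
      (subst (k ≤_) (trans (sym (k≰⇒⊒ k≤e k≰x x≢⊥)) (identityˡ x)) k≤e) k≰x

    ⇒-closed : ∀ {x y} → x ≢ bot → ¬ k ≤ y → ¬ k ≤ x ⇒ y
    ⇒-closed {x} {y} x≢⊥ k≰y k≤x⇒y =
      k≰y (subst (_≤ y) (trans (comm x k) (sym (k⊑ x≢⊥))) (residualʳ k≤x⇒y))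

    -- ⊥ ⇒ y is the top of 𝐂, which lies in 𝐁; in 𝐀 it is the largest element of 𝐀.
    residuum : Op₂ (Refinement Carrier (λ x → ¬ k ≤ x))
    residuum (x , _) (y , q) with x ≟ bot
    ... | yes _   = proj₁ greatest , [ proj₁ (proj₂ greatest) ]
    ... | no  x≢⊥ = x ⇒ y , Irrelevant.map (⇒-closed x≢⊥) q

    -- At `x ≡ bot` both sides always hold: the product is bottom, and `y`, being in the lower part,
    -- is below its largest element.
    residual : ∀ x (y : Refinement Carrier (λ x → ¬ k ≤ x)) z → ¬ k ≤ value y →
               (value x · value y ≤ value z) ⇔ (value y ≤ value (residuum x z))
    residual (x , _) (y , _) (z , _) k≰y with x ≟ bot
    ... | yes refl = mk⇔ (λ _ → proj₂ (proj₂ greatest) k≰y)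
                         (λ _ → subst (_≤ z) (sym (bot-zeroˡ y)) (bot-minimum z))
    ... | no  _    = residuation _ _ _

    open Restriction 𝐂 k≰?
      (λ k≰x _ k≤x∧y → k≰x (≤-trans k≤x∧y (proj₁ (infimum _ _))))
      k≰-∨ unit identity residuum residual public

  -- The isomorphism from the sum of the two parts

  𝐀 𝐁 : FiniteConservativeCRL a
  𝐀 = Lower.restriction
  𝐁 = Upper.restriction

  private
    module A = Properties 𝐀
    module B = Properties 𝐁
    module ⊕ = CatalanSumProperties 𝐀 𝐁

  -- The bottom of 𝐀 is computed from its own enumeration, so it has to be identified with that of
  -- 𝐂.
  value-bot : value A.bot ≡ bot
  value-bot = ≤bot (cong value (A.bot-minimum (bot , [ k≰bot ])))

  ≡bot⇒ : ∀ {x} → x ≡ A.bot → value x ≡ bot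
  ≡bot⇒ refl = value-bot

  ⇒≡bot : ∀ {x} → value x ≡ bot → x ≡ A.bot
  ⇒≡bot x≡⊥ = value-injective (trans x≡⊥ (sym value-bot))

  -- This justifies the pairs `≤↑e` of the sum: `e ∨ k` is the identity of 𝐁, so whatever is above
  -- it is above all of 𝐀.
  lower≤upperUnit : ∀ {x} → ¬ k ≤ x → x ≤ e ∨ k
  lower≤upperUnit {x} k≰x with x ≟ bot
  ... | yes refl = bot-minimum _
  ... | no  x≢⊥  = subst (x ≤_) x∨k≡e∨k x≤x∨y
    where
    open ≡-Reasoning
    x∨k≡e∨k : x ∨ k ≡ e ∨ k
    x∨k≡e∨k = begin
      x ∨ k             ≡⟨ cong₂ _∨_ (identityʳ x) (trans (comm x k) (sym (k⊑ x≢⊥))) ⟨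
      (x · e) ∨ (x · k) ≡⟨ ·-distribˡ-∨ x e k ⟨
      x · (e ∨ k)       ≡⟨ comm _ _ ⟩
      (e ∨ k) · x       ≡⟨ k≰⇒⊒ y≤x∨y k≰x x≢⊥ ⟩
      e ∨ k             ∎

  bijection : ⊕.Carrier ↔ Carrier
  bijection = mk↔ₛ′ [ value , value ]′ split value-split split-value
    where
    split : Carrier → ⊕.Carrier
    split x with k ≤? x
    ... | yes k≤x = inj₂ (x , [ k≤x ])
    ... | no  k≰x = inj₁ (x , [ k≰x ])
    value-split : ∀ x → [ value , value ]′ (split x) ≡ x
    value-split x with k ≤? x
    ... | yes _ = refl
    ... | no  _ = refl
    split-value : ∀ x → split ([ value , value ]′ x) ≡ x
    split-value (inj₁ x) with k ≤? value x
    ... | yes k≤x = contradiction k≤x (Lower.holds x)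
    ... | no  _   = refl
    split-value (inj₂ x) with k ≤? value x
    ... | yes _   = refl
    ... | no  k≰x = contradiction (Upper.holds x) k≰x

  open Inverse bijection using (to)

  preserve : ∀ {x y} → x ⊕.≤ y → to x ≤ to y
  preserve (⊕.≤ᴬ p)         = cong value p
  preserve (⊕.≤ᴮ p)         = cong value p
  preserve (⊕.⊥≤ refl)      = subst (_≤ _) (sym value-bot) (bot-minimum _)
  preserve (⊕.≤↑e {x} e≤y)  = ≤-trans (lower≤upperUnit (Lower.holds x)) (cong value e≤y)

  reflect : ∀ {x y} → to x ≤ to y → x ⊕.≤ y
  reflect {inj₁ _} {inj₁ _} p = ⊕.≤ᴬ (value-injective p)
  reflect {inj₂ _} {inj₂ _} p = ⊕.≤ᴮ (value-injective p)
  reflect {inj₂ x} {inj₁ y} p = contradiction (≤-trans (Upper.holds x) p) (Lower.holds y)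
  reflect {inj₁ x} {inj₂ y} p = by-cases (value x ≟ bot)
    where
    e∨k≤y : value x ≢ bot → e ∨ k ≤ value y
    -- Multiplying `value x ≤ value y` by `e ∨ k` turns the left side into `e ∨ k`, by the key
    -- observation, and fixes the right side.
    e∨k≤y x≢⊥ = subst (_≤ value y) (k≰⇒⊒ y≤x∨y (Lower.holds x) x≢⊥)
      (subst ((e ∨ k) · value x ≤_) (Upper.identity (Upper.holds y)) (·-monoʳ (e ∨ k) p))
    by-cases : Dec (value x ≡ bot) → inj₁ x ⊕.≤ inj₂ y
    by-cases (yes x≡⊥) = ⊕.⊥≤ (⇒≡bot x≡⊥)
    by-cases (no  x≢⊥) = ⊕.≤↑e (value-injective (e∨k≤y x≢⊥))

  prodᴬᴮ-homo : ∀ x y → to (⊕.prodᴬᴮ x y) ≡ value x · value y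
  prodᴬᴮ-homo x y = by-cases (x A.≟ A.bot)
    where
    open ≡-Reasoning
    by-cases : Dec (x ≡ A.bot) → to (⊕.prodᴬᴮ x y) ≡ value x · value y
    by-cases (yes x≡⊥) = begin
      to (⊕.prodᴬᴮ x y) ≡⟨ cong to (⊕.prodᴬᴮ-⊥ x≡⊥ y) ⟩
      value x           ≡⟨ ≡bot⇒ x≡⊥ ⟩
      bot               ≡⟨ bot-zeroˡ _ ⟨
      bot · value y     ≡⟨ cong (_· value y) (≡bot⇒ x≡⊥) ⟨
      value x · value y ∎
    by-cases (no x≢⊥) = begin
      to (⊕.prodᴬᴮ x y) ≡⟨ cong to (⊕.prodᴬᴮ-≢⊥ x≢⊥ y) ⟩
      value y           ≡⟨ k≰⇒⊒ (Upper.holds y) (Lower.holds x) (x≢⊥ ∘ ⇒≡bot) ⟨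
      value y · value x ≡⟨ comm _ _ ⟩
      value x · value y ∎

  ·-homo : Homomorphic₂ ⊕.Carrier Carrier _≡_ to ⊕._·_ _·_
  ·-homo (inj₁ _) (inj₁ _) = refl
  ·-homo (inj₁ x) (inj₂ y) = prodᴬᴮ-homo x y
  ·-homo (inj₂ x) (inj₁ y) = trans (prodᴬᴮ-homo y x) (comm _ _)
  ·-homo (inj₂ _) (inj₂ _) = refl

  𝐀©𝐁≅𝐂 : 𝐀 © 𝐁 ≅ raw
  𝐀©𝐁≅𝐂 = order-product-iso ⊕.sum-crl 𝐂 bijection
    (preserve ∘ Equivalence.from ⊕.≤⇔≤) (Equivalence.to ⊕.≤⇔≤ ∘ reflect) ·-homo

  𝐀-smaller : proj₁ A.finite < proj₁ finite
  𝐀-smaller = refinement-size Lower.k≰? finite (λ k≰k → k≰k ≤-refl)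

  𝐁-smaller : proj₁ B.finite < proj₁ finite
  𝐁-smaller = refinement-size (k ≤?_) finite k≰bot

-- Induction on the size

module _ (𝐂 : FiniteConservativeCRL a) where
  open Properties 𝐂

  e≡bot⇒≡bot : e ≡ bot → ∀ x → x ≡ bot
  e≡bot⇒≡bot e≡⊥ x = trans (sym (identityˡ x)) (trans (cong (_· x) e≡⊥) (bot-zeroˡ x))

  e≡bot⇒𝟙≅ : e ≡ bot → 𝟙 ≅ raw
  e≡bot⇒𝟙≅ e≡⊥ = record
    { bijection = mk↔ₛ′ (λ _ → bot) (λ _ → tt) (λ x → sym (trivial x)) (λ _ → refl)
    ; ∧-homo = λ _ _ → sym (trivial _)
    ; ∨-homo = λ _ _ → sym (trivial _)
    ; ·-homo = λ _ _ → sym (trivial _)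
    ; ⇒-homo = λ _ _ → sym (trivial _)
    ; e-homo = sym e≡⊥
    }
    where trivial = e≡bot⇒≡bot e≡⊥

-- The recursion is structural in `n`, a strict bound on the size, which makes the case of `zero`
-- empty. The test `e ≡ bot` detects the one-element algebra.
finiteConservativeCRL⇒catalan : ∀ n (𝐂 : FiniteConservativeCRL a) → let open Properties 𝐂 in
                                proj₁ finite < n → Catalan raw
finiteConservativeCRL⇒catalan (suc n) 𝐂 size<n
  with Properties._≟_ 𝐂 (Properties.e 𝐂) (Properties.bot 𝐂)
... | yes e≡⊥ = iso (e≡bot⇒𝟙≅ 𝐂 e≡⊥) one
... | no  e≢⊥ = iso 𝐀©𝐁≅𝐂 (sum 𝐀 𝐁 (summand 𝐀 𝐀-smaller) (summand 𝐁 𝐁-smaller))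
  where
  open Decomposition 𝐂 e≢⊥
  summand = λ 𝐃 smaller →
    finiteConservativeCRL⇒catalan n 𝐃 (<-≤-trans smaller (≤-pred size<n))

theorem5p5 : ∀ {a} (A : RawResiduatedLattice a) → IsFiniteConservativeCRL A ⇔ Catalan A
theorem5p5 A = mk⇔
  (λ A-fccrl → finiteConservativeCRL⇒catalan _ record { isFiniteConservativeCRL = A-fccrl } (n<1+n _))
  catalan⇒finiteConservativeCRL
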